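{- Let $n\ge 1$ and let $\mu=(\mu_1,\mu_2,\ldots,\mu_n)$ be a partition of length $\ell(\mu)=n$ whose parts are all distinct, and put $m=\mu_1$. Then the mapping $\Psi=\phi^{ -1}\circ\psi$ defines a bijection between the set $\mathcal{ST}^\mu(n,\overline n)$ of $sp(2n)$-standard shifted tableaux of shape $SF^\mu$ and the set $\mathcal{UA}^\mu(2n)$ of $2n\times m$ $\mu$-alternating sign matrices with a U-turn boundary.
   Context: Shifted diagram: for a partition $\mu$ with $n$ distinct positive parts, $SF^\mu=\{(i,j): 1\le i\le n,\ i\le j\le \mu_i+i-1\}$ (row $i$, column $j$). Alphabet: $[n,\overline n]=\{1,\ldots,n\}\cup\{\overline1,\ldots,\overline n\}$ ordered by $\overline1<1<\overline2<2<\cdots<\overline n<n$. $\mathcal{ST}^\mu(n,\overline n)$ is the set of fillings $ST=(\eta_{ij})_{(i,j)\in SF^\mu}$ with $\eta_{ij}\in[n,\overline n]$ such that $\eta_{ii}\in\{i,\overline i\}$ for $1\le i\le n$; $\eta_{ij}\le\eta_{i,j+1}$; $\eta_{ij}\le\eta_{i+1,j}$; and $\eta_{ij}<\eta_{i+1,j+1}$, whenever the boxes concerned lie in $SF^\mu$. $\mathcal{UA}^\mu(2n)$ (with $m=\mu_1$) is the set of $2n\times m$ matrices $UA=(a_{iq})$ with: (UA1) $a_{iq}\in\{ -1,0,1\}$; (UA2) $\sum_{q=p}^m a_{iq}\in\{0,1\}$ for $1\le i\le 2n$, $1\le p\le m$; (UA3) $\sum_{i=j}^{2n}a_{iq}\in\{0,1\}$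 for $1\le j\le 2n$, $1\le q\le m$; (UA4) $\sum_{q=1}^m(a_{2i-1,q}+a_{2i,q})=1$ for $1\le i\le n$; (UA5) for $1\le q\le m$, $\sum_{i=1}^{2n}a_{iq}=1$ if $q=\mu_k$ for some $k$, and $=0$ otherwise. The map $\psi$: label the rows of $2n\times m$ matrices from top to bottom by $n,\overline n,n-1,\overline{n-1},\ldots,1,\overline1$. For $ST\in\mathcal{ST}^\mu(n,\overline n)$, $\psi(ST)$ is the $2n\times m$ matrix of signs whose entry in the row labelled $c\in[n,\overline n]$ and column $q$ is $+$ if the entry $c$ occurs in $ST$ on the $q$-th diagonal $\{(i,i+q-1)\}$ of $SF^\mu$, and $-$ otherwise. The map $\phi$: for $UA\in\mathcal{UA}^\mu(2n)$, a zero entry is called positive if the nearest non-zero entry to its right in the same row exists and equals $1$; all other zeros are negative. $\phi(UA)$ is the sign matrix obtained by replacing $1$'s and positive zeros by $+$, and $-1$'s and negative zeros by $-$. The inverse $\phi^{ -1}$ is applied to a sign matrix row by row: the right-most $+$ of each maximal run of consecutive $+$'s becomes $1$ and the other $+$'s become $0$; the right-most $-$ of each maximal run of consecutive $-$'s becomes $-1$ if its immediate right-hand neighbour is (exists and is) $+$; all other $-$'s become $0$. -}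

module Defs where

open import Data.Bool.Base using (if_then_else_)
open import Data.Fin.Base as Fin using (Fin; zero; suc; toℕ; combine; remQuot; opposite)
open import Data.Fin.Patterns using (0F; 1F)
open import Data.Fin.Properties using (any?) renaming (_≟_ to _≟ᶠ_)
open import Data.Integer.Base as ℤ using (ℤ; 0ℤ; 1ℤ; -1ℤ; +0; +[1+_]; -[1+_])
open import Data.Integer.Properties using (+-0-commutativeMonoid)
open import Data.Maybe.Base using (Maybe; just; nothing)
open import Data.Nat.Base as ℕ using (ℕ; zero; suc; NonZero)
open import Data.Nat.Properties using (_≤?_; _<?_)
open import Data.Product.Base using (Σ-syntax; ∃-syntax; _×_; _,_; proj₁)
open import Data.Sign.Base using (Sign; +; -)
open import Data.Sum.Base using (_⊎_)
open import Data.Vec.Functional using (Vector; head; tail)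
open import Function.Base using (_on_)
open import Function.Definitions using (Injective)
open import Relation.Binary.Core using (Rel)
open import Relation.Binary.PropositionalEquality using (_≡_; refl; trans; cong)
open import Relation.Nullary.Decidable using (Dec; yes; no; does; map′; _×-dec_)
open import Relation.Nullary.Negation using (¬_)

open import Algebra.Properties.CommutativeMonoid.Sum +-0-commutativeMonoid
  using (sum)

-- All rows, columns and diagonals are indexed from 0, so index k here
-- is index k + 1 in the usual 1-based notation.

record DistinctPartition (n : ℕ) : Set where
  field
    part          : Fin n → ℕ
    nonincreasing : ∀ {i j} → i Fin.≤ j → part j ℕ.≤ part i
    positive      : ∀ i → 0 ℕ.< part i
    distinct      : Injective _≡_ _≡_ part

open DistinctPartition public

largestPart : ∀ {n} .{{_ : NonZero n}} → DistinctPartition n → ℕ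
largestPart {suc _} μ = part μ zero

------------------------------------------------------------------------
-- The alphabet  1̄ < 1 < 2̄ < 2 < ⋯ < n̄ < n

data Letter (n : ℕ) : Set where
  barred unbarred : Fin n → Letter n

rank : ∀ {n} → Letter n → ℕ
rank (barred k)   = 2 ℕ.* toℕ k
rank (unbarred k) = suc (2 ℕ.* toℕ k)

infix 4 _≤ᴸ_ _<ᴸ_ _≟ᴸ_

_≤ᴸ_ _<ᴸ_ : ∀ {n} → Rel (Letter n) _
_≤ᴸ_ = ℕ._≤_ on rank
_<ᴸ_ = ℕ._<_ on rank

_≟ᴸ_ : ∀ {n} (c d : Letter n) → Dec (c ≡ d)
barred k   ≟ᴸ barred l   = map′ (cong barred) (λ { refl → refl }) (k ≟ᶠ l)
barred _   ≟ᴸ unbarred _ = no λ ()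
unbarred _ ≟ᴸ barred _   = no λ ()
unbarred k ≟ᴸ unbarred l = map′ (cong unbarred) (λ { refl → refl }) (k ≟ᶠ l)

------------------------------------------------------------------------
-- Shifted diagrams and sp(2n)-standard shifted tableaux

-- In 1-based coordinates: i ≤ j ≤ μᵢ + i − 1.
_∈SF_ : ∀ {n} → Fin n × ℕ → DistinctPartition n → Set
(i , j) ∈SF μ = toℕ i ℕ.≤ j × j ℕ.< part μ i ℕ.+ toℕ i

-- Membership proofs are irrelevant arguments, so that a filling depends
-- on the box only.
Filling : ∀ {n} → DistinctPartition n → Set
Filling {n} μ = ∀ (i : Fin n) (j : ℕ) → .((i , j) ∈SF μ) → Letter n

record ST {n : ℕ} (μ : DistinctPartition n) : Set where
  field
    η        : Filling μ
    diagonal : ∀ i .(b : (i , toℕ i) ∈SF μ) →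
               η i (toℕ i) b ≡ unbarred i ⊎ η i (toℕ i) b ≡ barred i
    rows     : ∀ i j .(b : (i , j) ∈SF μ) .(b′ : (i , suc j) ∈SF μ) →
               η i j b ≤ᴸ η i (suc j) b′
    columns  : ∀ i i⁺ j → toℕ i⁺ ≡ suc (toℕ i) →
               .(b : (i , j) ∈SF μ) .(b′ : (i⁺ , j) ∈SF μ) →
               η i j b ≤ᴸ η i⁺ j b′
    diagonals : ∀ i i⁺ j → toℕ i⁺ ≡ suc (toℕ i) →
                .(b : (i , j) ∈SF μ) .(b′ : (i⁺ , suc j) ∈SF μ) →
                η i j b <ᴸ η i⁺ (suc j) b′

open ST public

_≈ST_ : ∀ {n} {μ : DistinctPartition n} → Rel (ST μ) _
_≈ST_ {μ = μ} S T = ∀ i j .(b : (i , j) ∈SF μ) → η S i j b ≡ η T i j b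

OccursOnDiagonal : ∀ {n} {μ : DistinctPartition n} → Letter n → ℕ → ST μ → Set
OccursOnDiagonal {μ = μ} c q T =
  ∃[ i ] Σ[ b ∈ (i , toℕ i ℕ.+ q) ∈SF μ ] η T i (toℕ i ℕ.+ q) b ≡ c

occursOnDiagonal? : ∀ {n} {μ : DistinctPartition n} c q (T : ST μ) →
                    Dec (OccursOnDiagonal c q T)
occursOnDiagonal? {μ = μ} c q T = any? λ i → atRow i
  where
  atRow : ∀ i → Dec (Σ[ b ∈ (i , toℕ i ℕ.+ q) ∈SF μ ] η T i (toℕ i ℕ.+ q) b ≡ c)
  atRow i with (toℕ i ≤? toℕ i ℕ.+ q) ×-dec (toℕ i ℕ.+ q <? part μ i ℕ.+ toℕ i)
  ... | no ¬b = no λ (b , _) → ¬b b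
  ... | yes b = map′ (λ eq → b , eq) (λ (_ , eq) → eq) (η T i (toℕ i ℕ.+ q) b ≟ᴸ c)

------------------------------------------------------------------------
-- μ-alternating sign matrices with a U-turn boundary

Matrix : Set → ℕ → ℕ → Set
Matrix A r c = Fin r → Fin c → A

sumFrom : ∀ {k} → Fin k → Vector ℤ k → ℤ
sumFrom zero    v = sum v
sumFrom (suc p) v = sumFrom p (tail v)

ZeroOrOne : ℤ → Set
ZeroOrOne x = x ≡ 0ℤ ⊎ x ≡ 1ℤ

-- There are n * 2 rows rather than 2 * n because combine k 0F and
-- combine k 1F are then the consecutive rows 2k and 2k + 1.
record IsUA {n : ℕ} .{{_ : NonZero n}} (μ : DistinctPartition n)
            (a : Matrix ℤ (n ℕ.* 2) (largestPart μ)) : Set where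
  field
    UA1 : ∀ i q → a i q ≡ -1ℤ ⊎ a i q ≡ 0ℤ ⊎ a i q ≡ 1ℤ
    UA2 : ∀ i p → ZeroOrOne (sumFrom p (λ q → a i q))
    UA3 : ∀ j q → ZeroOrOne (sumFrom j (λ i → a i q))
    UA4 : ∀ (k : Fin n) → sum (λ q → a (combine k 0F) q ℤ.+ a (combine k 1F) q) ≡ 1ℤ
    UA5 : ∀ q →
          ((∃[ k ] suc (toℕ q) ≡ part μ k) → sum (λ i → a i q) ≡ 1ℤ) ×
          (¬ (∃[ k ] suc (toℕ q) ≡ part μ k) → sum (λ i → a i q) ≡ 0ℤ)

UA : ∀ {n} .{{_ : NonZero n}} → DistinctPartition n → Set
UA {n} μ = Σ[ a ∈ Matrix ℤ (n ℕ.* 2) (largestPart μ) ] IsUA μ a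

_≈UA_ : ∀ {n} .{{_ : NonZero n}} {μ : DistinctPartition n} → Rel (UA μ) _
A ≈UA B = ∀ i q → proj₁ A i q ≡ proj₁ B i q

------------------------------------------------------------------------
-- The map ψ

-- Rows are labelled n, n̄, n−1, …, 1, 1̄ from top to bottom.
rowLabel : ∀ {n} → Fin (n ℕ.* 2) → Letter n
rowLabel {n} r with remQuot {n} 2 r
... | k , 0F = unbarred (opposite k)
... | k , 1F = barred (opposite k)

ψ : ∀ {n} .{{_ : NonZero n}} {μ : DistinctPartition n} →
    ST μ → Matrix Sign (n ℕ.* 2) (largestPart μ)
ψ T r q = if does (occursOnDiagonal? (rowLabel r) (toℕ q) T) then + else -

------------------------------------------------------------------------
-- The maps φ and φ⁻¹

nearestNonzero : ∀ {m} → Vector ℤ m → Maybe ℤ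
nearestNonzero {zero}  v = nothing
nearestNonzero {suc m} v with head v
... | +0 = nearestNonzero (tail v)
... | x  = just x

zeroSign : Maybe ℤ → Sign
zeroSign (just +[1+ 0 ]) = +
zeroSign _               = -

φRow : ∀ {m} → Vector ℤ m → Vector Sign m
φRow v (suc q) = φRow (tail v) q
φRow v zero with head v
... | +0       = zeroSign (nearestNonzero (tail v))
... | +[1+ _ ] = +
... | -[1+ _ ] = -

φ : ∀ {r m} → Matrix ℤ r m → Matrix Sign r m
φ a i = φRow (a i)

rightNeighbour : ∀ {A : Set} {m} → Vector A m → Fin m → Maybe A
rightNeighbour {m = suc zero}    v zero    = nothing
rightNeighbour {m = suc (suc _)} v zero    = just (v 1F)
rightNeighbour                   v (suc q) = rightNeighbour (tail v) q

-- A sign is the right-most of its maximal run exactly when its right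
-- neighbour is missing or is the opposite sign.
unsign : (s : Sign) (right : Maybe Sign) → ℤ
unsign + (just +) = 0ℤ
unsign + (just -) = 1ℤ
unsign + nothing  = 1ℤ
unsign - (just +) = -1ℤ
unsign - (just -) = 0ℤ
unsign - nothing  = 0ℤ

φ⁻¹Row : ∀ {m} → Vector Sign m → Vector ℤ m
φ⁻¹Row s q = unsign (s q) (rightNeighbour s q)

φ⁻¹ : ∀ {r m} → Matrix Sign r m → Matrix ℤ r m
φ⁻¹ s i = φ⁻¹Row (s i)

-- The name is justified: φ⁻¹ s is a φ-preimage of every sign matrix s.
nearestNonzero-φ⁻¹Row : ∀ {m} (s : Vector Sign (suc m)) →
                        zeroSign (nearestNonzero (φ⁻¹Row s)) ≡ head s
nearestNonzero-φ⁻¹Row {zero} s with s 0F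
... | + = refl
... | - = refl
nearestNonzero-φ⁻¹Row {suc m} s with s 0F | s 1F in s₁
... | + | + = trans (nearestNonzero-φ⁻¹Row (tail s)) s₁
... | + | - = refl
... | - | + = refl
... | - | - = trans (nearestNonzero-φ⁻¹Row (tail s)) s₁

φRow-φ⁻¹Row : ∀ {m} (s : Vector Sign m) q → φRow (φ⁻¹Row s) q ≡ s q
φRow-φ⁻¹Row {suc (suc m)} s (suc q) = φRow-φ⁻¹Row (tail s) q
φRow-φ⁻¹Row {suc zero} s zero with s 0F
... | + = refl
... | - = refl
φRow-φ⁻¹Row {suc (suc m)} s zero with s 0F | s 1F in s₁
... | + | + = trans (nearestNonzero-φ⁻¹Row (tail s)) s₁
... | + | - = refl
... | - | + = refl
... | - | - = trans (nearestNonzero-φ⁻¹Row (tail s)) s₁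

φ-φ⁻¹ : ∀ {r m} (s : Matrix Sign r m) i q → φ (φ⁻¹ s) i q ≡ s i q
φ-φ⁻¹ s i = φRow-φ⁻¹Row (s i)

Ψ : ∀ {n} .{{_ : NonZero n}} {μ : DistinctPartition n} →
    ST μ → Matrix ℤ (n ℕ.* 2) (largestPart μ)
Ψ T = φ⁻¹ (ψ T)

-- A tableau is encoded by its corner sums: N q j is the number of entries on
-- diagonal q whose letter labels matrix row j or a lower one. Diagonals are
-- strictly increasing, so entry k of diagonal q has this property exactly
-- when k < N q j, and every condition on a tableau becomes one on N:
-- strictness of a diagonal says N q j − N q (j + 1) ∈ {0, 1}, the interlacing
-- of neighbouring diagonals (rows and columns weakly increasing) says
-- N q j − N (q + 1) j ∈ {0, 1}, the shape fixes N q 0, and the condition on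
-- the main diagonal fixes N 0 on even rows. On the other side φ⁻¹ takes
-- differences of neighbouring signs, so Ψ T is the mixed second difference
-- of N. Telescoping turns (UA2)–(UA5) into the same four conditions, and N is
-- recovered from the matrix by summing over lower right corners.
module Submission where

open import Defs
open import Data.Bool.Base using (true; false; if_then_else_)
open import Data.Empty using (⊥-elim)
open import Data.Fin.Base
  using (Fin; zero; suc; toℕ; fromℕ<; combine; remQuot; opposite; inject₁)
open import Data.Fin.Induction using (<-weakInduction)
open import Data.Fin.Patterns using (0F; 1F)
open import Data.Fin.Properties
  using (any?; toℕ<n; toℕ-fromℕ<; toℕ-injective; toℕ-inject₁; toℕ-combine;
         opposite-prop; opposite-involutive; remQuot-combine; combine-remQuot)
open import Data.Integer.Base as ℤ using (ℤ; +_; 0ℤ; 1ℤ; -1ℤ; ∣_∣)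
import Data.Integer.Properties as ℤₚ
open import Data.Integer.Tactic.RingSolver using (solve-∀)
open import Data.Nat.Base
  using (ℕ; zero; suc; _+_; _*_; _∸_; _≤_; _<_; z≤n; s≤s; s≤s⁻¹; NonZero)
open import Data.Nat.Properties
open import Data.Nat.Tactic.RingSolver using () renaming (solve-∀ to solveℕ-∀)
open import Data.Product.Base using (Σ-syntax; ∃-syntax; _×_; _,_; proj₁; proj₂)
open import Data.Sign.Base as Sign using (Sign)
open import Data.Sum.Base using (_⊎_; inj₁; inj₂)
open import Data.Vec.Functional using (Vector; head; tail)
open import Function.Base using (_∘_)
open import Function.Bundles using (_⇔_; mk⇔; Equivalence)
open import Function.Structures using (IsBijection)
open import Relation.Binary.PropositionalEquality
  using (_≡_; refl; sym; trans; cong; cong₂; subst; module ≡-Reasoning)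
open import Relation.Nullary.Decidable using (Dec; yes; no; does; map′; recompute; _×-dec_)
open import Relation.Nullary.Negation using (¬_; contradiction)
open import Relation.Unary using (Decidable)

open import Algebra.Properties.CommutativeMonoid.Sum ℤₚ.+-0-commutativeMonoid
  using (sum; sum-cong-≗; ∑-distrib-+)

open Equivalence using (to; from)

-- Rows of the matrices and letters

row : ∀ {n} → Letter n → Fin (n * 2)
row (unbarred k) = combine (opposite k) 0F
row (barred k)   = combine (opposite k) 1F

rowLabel-combine₀ : ∀ {n} (k : Fin n) → rowLabel (combine k 0F) ≡ unbarred (opposite k)
rowLabel-combine₀ k rewrite remQuot-combine {k = 2} k 0F = refl

rowLabel-combine₁ : ∀ {n} (k : Fin n) → rowLabel (combine k 1F) ≡ barred (opposite k)
rowLabel-combine₁ k rewrite remQuot-combine {k = 2} k 1F = refl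

rowLabel-row : ∀ {n} (c : Letter n) → rowLabel (row c) ≡ c
rowLabel-row (unbarred k) =
  trans (rowLabel-combine₀ (opposite k)) (cong unbarred (opposite-involutive k))
rowLabel-row (barred k) =
  trans (rowLabel-combine₁ (opposite k)) (cong barred (opposite-involutive k))

row-rowLabel : ∀ {n} (i : Fin (n * 2)) → row (rowLabel {n} i) ≡ i
row-rowLabel {n} i = subst (λ i → row (rowLabel {n} i) ≡ i) (combine-remQuot {n} 2 i)
  (row-rowLabel-combine (proj₁ (remQuot {n} 2 i)) (proj₂ (remQuot {n} 2 i)))
  where
  row-rowLabel-combine : ∀ (k : Fin n) b → row (rowLabel {n} (combine k b)) ≡ combine k b
  row-rowLabel-combine k 0F rewrite rowLabel-combine₀ k =
    cong (λ l → combine l 0F) (opposite-involutive k)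
  row-rowLabel-combine k 1F rewrite rowLabel-combine₁ k =
    cong (λ l → combine l 1F) (opposite-involutive k)

row-injective : ∀ {n} {c d : Letter n} → row c ≡ row d → c ≡ d
row-injective {c = c} {d} eq =
  trans (sym (rowLabel-row c)) (trans (cong rowLabel eq) (rowLabel-row d))

opposite-+ : ∀ {n} (k : Fin n) → toℕ (opposite k) + suc (toℕ k) ≡ n
opposite-+ k =
  trans (cong (_+ suc (toℕ k)) (opposite-prop k)) (m∸n+n≡m (toℕ<n k))

toℕ-combine₀ : ∀ {n} (k : Fin n) → toℕ (combine k (zero {1})) ≡ toℕ k * 2
toℕ-combine₀ k = trans (toℕ-combine k 0F) (trans (+-identityʳ _) (*-comm 2 (toℕ k)))

toℕ-combine₁ : ∀ {n} (k : Fin n) → toℕ (combine k (suc (zero {0}))) ≡ suc (toℕ k * 2)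
toℕ-combine₁ k = trans (toℕ-combine k 1F) (trans (+-comm _ 1) (cong suc (*-comm 2 (toℕ k))))

-- Matrix rows are labelled from the largest letter down, so rank and row number are complementary.
-- With a constant sum, every comparison of letters becomes the reversed comparison of rows, via
-- `≤-exchange` and `<-exchange`.
rank+row : ∀ {n} (c : Letter n) → rank c + suc (toℕ (row c)) ≡ n * 2
rank+row {n} c = trans (lemma c) (trans (cong (2 *_) (opposite-+ (index c))) (*-comm 2 n))
  where
  index : Letter n → Fin n
  index (unbarred k) = k
  index (barred k)   = k

  even : ∀ x y → suc (2 * x) + suc (y * 2) ≡ 2 * (y + suc x)
  even = solveℕ-∀

  odd : ∀ x y → 2 * x + suc (suc (y * 2)) ≡ 2 * (y + suc x)
  odd = solveℕ-∀

  lemma : ∀ c → rank c + suc (toℕ (row c)) ≡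
                2 * (toℕ (opposite (index c)) + suc (toℕ (index c)))
  lemma (unbarred k) rewrite toℕ-combine₀ (opposite k) = even (toℕ k) (toℕ (opposite k))
  lemma (barred k)   rewrite toℕ-combine₁ (opposite k) = odd (toℕ k) (toℕ (opposite k))

≤-exchange : ∀ {a b x y} → a + x ≡ b + y → y ≤ x → a ≤ b
≤-exchange {a} {b} {x} {y} eq y≤x =
  +-cancelʳ-≤ x a b (≤-trans (≤-reflexive eq) (+-monoʳ-≤ b y≤x))

<-exchange : ∀ {a b x y} → a + x ≡ b + y → y < x → a < b
<-exchange {a} {b} {x} {y} eq y<x =
  +-cancelʳ-< x a b (≤-<-trans (≤-reflexive eq) (+-monoʳ-< b y<x))

module _ {n} (c d : Letter n) where

  rank-row-≡ : rank c + suc (toℕ (row c)) ≡ rank d + suc (toℕ (row d))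
  rank-row-≡ = trans (rank+row c) (sym (rank+row d))

  row-rank-≡ : suc (toℕ (row c)) + rank c ≡ suc (toℕ (row d)) + rank d
  row-rank-≡ = trans (+-comm _ (rank c)) (trans rank-row-≡ (+-comm (rank d) _))

  row≤⇒≤ᴸ : toℕ (row d) ≤ toℕ (row c) → c ≤ᴸ d
  row≤⇒≤ᴸ = ≤-exchange rank-row-≡ ∘ s≤s

  row<⇒<ᴸ : toℕ (row d) < toℕ (row c) → c <ᴸ d
  row<⇒<ᴸ = <-exchange rank-row-≡ ∘ s≤s

  ≤ᴸ⇒row≤ : c ≤ᴸ d → toℕ (row d) ≤ toℕ (row c)
  ≤ᴸ⇒row≤ = s≤s⁻¹ ∘ ≤-exchange (sym row-rank-≡)

  <ᴸ⇒row< : c <ᴸ d → toℕ (row d) < toℕ (row c)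
  <ᴸ⇒row< = s≤s⁻¹ ∘ <-exchange (sym row-rank-≡)

-- Initial segments of Fin n

-- If `N′ < N`, then `N′` itself is an index in `Fin n` below `N`, and the hypothesis makes it
-- smaller than itself.
≤-fromFin : ∀ {n N N′} → N ≤ n → (∀ (k : Fin n) → toℕ k < N → toℕ k < N′) → N ≤ N′
≤-fromFin {N′ = N′} N≤n below = ≮⇒≥ λ N′<N →
  let N′<n = <-≤-trans N′<N N≤n
      eq   = toℕ-fromℕ< N′<n
  in n≮n N′ (subst (_< N′) eq (below (fromℕ< N′<n) (subst (_< _) (sym eq) N′<N)))

-- The cardinality of an initial segment of `Fin n`, characterised by membership. Comparing two
-- cardinalities then amounts to an implication between predicates, and nothing is ever counted.
record Threshold {n} (P : Fin n → Set) : Set where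
  field
    value   : ℕ
    bounded : value ≤ n
    spec    : ∀ k → toℕ k < value ⇔ P k

  value-unique : ∀ {N} → N ≤ n → (∀ k → toℕ k < N ⇔ P k) → value ≡ N
  value-unique N≤n spec′ = ≤-antisym
    (≤-fromFin bounded λ k → from (spec′ k) ∘ to (spec k))
    (≤-fromFin N≤n λ k → from (spec k) ∘ to (spec′ k))

open Threshold

module _ {n} {P Q : Fin n → Set} (t : Threshold P) (u : Threshold Q) where

  value-mono : (∀ k → P k → Q k) → value t ≤ value u
  value-mono P⇒Q = ≤-fromFin (bounded t) λ k → from (spec u k) ∘ P⇒Q k ∘ to (spec t k)

  -- Apart from index 0, every member of the first segment has its predecessor in the second.
  -- Together with `value-mono` this yields unit steps.
  value-shift : (∀ k k⁺ → toℕ k⁺ ≡ suc (toℕ k) → P k⁺ → Q k) → value t ≤ suc (value u)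
  value-shift P⇒Q = ≤-fromFin (bounded t) λ
    { zero    _ → s≤s z≤n
    ; (suc k) k<t → s≤s (subst (_< value u) (toℕ-inject₁ k)
        (from (spec u (inject₁ k))
          (P⇒Q (inject₁ k) (suc k) (cong suc (sym (toℕ-inject₁ k))) (to (spec t (suc k)) k<t)))) }

threshold : ∀ {n} {P : Fin n → Set} → Decidable P →
            (∀ k k⁺ → toℕ k⁺ ≡ suc (toℕ k) → P k⁺ → P k) → Threshold P
threshold {zero}      P? down = record { value = 0 ; bounded = z≤n ; spec = λ () }
threshold {suc n} {P} P? down with P? zero
... | no ¬P0 = record
  { value   = 0
  ; bounded = z≤n
  ; spec    = λ k → mk⇔ (λ ()) (⊥-elim ∘ ¬P k)
  }
  where
  -- A downward closed predicate that fails at 0 fails everywhere.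
  ¬P : ∀ k → ¬ P k
  ¬P = <-weakInduction (λ k → ¬ P k) ¬P0 λ i ¬Pi →
    ¬Pi ∘ down (inject₁ i) (suc i) (cong suc (sym (toℕ-inject₁ i)))
... | yes P0 = record
  { value   = suc (value t)
  ; bounded = s≤s (bounded t)
  ; spec    = λ
    { zero    → mk⇔ (λ _ → P0) (λ _ → s≤s z≤n)
    ; (suc k) → mk⇔ (to (spec t k) ∘ s≤s⁻¹) (s≤s ∘ from (spec t k)) }
  }
  where
  t : Threshold (P ∘ suc)
  t = threshold (P? ∘ suc) λ k k⁺ eq → down (suc k) (suc k⁺) (cong suc eq)

-- Suffix sums

-- Unlike `sumFrom`, the start ranges over all of `ℕ`, and past the end the sum is empty.
-- Differences of consecutive suffix sums thus need no special case at the last entry.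
sumDrop : ∀ {k} → ℕ → Vector ℤ k → ℤ
sumDrop         zero    v = sum v
sumDrop {zero}  (suc p) v = 0ℤ
sumDrop {suc k} (suc p) v = sumDrop p (tail v)

sumFrom≡sumDrop : ∀ {k} (p : Fin k) v → sumFrom p v ≡ sumDrop (toℕ p) v
sumFrom≡sumDrop zero    v = refl
sumFrom≡sumDrop (suc p) v = sumFrom≡sumDrop p (tail v)

sumDrop-vanish : ∀ {k p} (v : Vector ℤ k) → k ≤ p → sumDrop p v ≡ 0ℤ
sumDrop-vanish {zero}  {zero}  v _   = refl
sumDrop-vanish {zero}  {suc p} v _   = refl
sumDrop-vanish {suc k} {suc p} v k≤p = sumDrop-vanish (tail v) (s≤s⁻¹ k≤p)

private
  x≡x+y-y : ∀ x y → x ≡ x ℤ.+ y ℤ.- y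
  x≡x+y-y = solve-∀

  x≡x-y+y : ∀ x y → x ≡ x ℤ.- y ℤ.+ y
  x≡x-y+y = solve-∀

  exchange-differences : ∀ a b c d →
    (a ℤ.- b) ℤ.- (c ℤ.- d) ≡ (a ℤ.- c) ℤ.- (b ℤ.- d)
  exchange-differences = solve-∀

  join-differences : ∀ a b c d e f →
    ((a ℤ.- b) ℤ.- (d ℤ.- e)) ℤ.+ ((b ℤ.- c) ℤ.- (e ℤ.- f)) ≡ (a ℤ.- c) ℤ.- (d ℤ.- f)
  join-differences = solve-∀

sumDrop-suc : ∀ {k} (v : Vector ℤ k) i →
              sumDrop (toℕ i) v ≡ v i ℤ.+ sumDrop (suc (toℕ i)) v
sumDrop-suc v zero    = refl
sumDrop-suc v (suc i) = sumDrop-suc (tail v) i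

entry-difference : ∀ {k} (v : Vector ℤ k) i →
                   v i ≡ sumDrop (toℕ i) v ℤ.- sumDrop (suc (toℕ i)) v
entry-difference v i = trans (x≡x+y-y (v i) (sumDrop (suc (toℕ i)) v))
  (cong (ℤ._- sumDrop (suc (toℕ i)) v) (sym (sumDrop-suc v i)))

-- Since `G` vanishes past the end, telescoping leaves no boundary term there.
sumDrop-telescope : ∀ {k} (v : Vector ℤ k) (G : ℕ → ℤ) → (∀ {p} → k ≤ p → G p ≡ 0ℤ) →
                    (∀ i → v i ≡ G (toℕ i) ℤ.- G (suc (toℕ i))) →
                    ∀ p → sumDrop p v ≡ G p
sumDrop-telescope {zero}  v G vanish diff zero    = sym (vanish z≤n)
sumDrop-telescope {zero}  v G vanish diff (suc p) = sym (vanish z≤n)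
sumDrop-telescope {suc k} v G vanish diff zero    = begin
  head v ℤ.+ sum (tail v)  ≡⟨ cong₂ ℤ._+_ (diff zero) tail-sum ⟩
  (G 0 ℤ.- G 1) ℤ.+ G 1    ≡⟨ x≡x-y+y (G 0) (G 1) ⟨
  G 0                      ∎
  where
  open ≡-Reasoning
  tail-sum : sum (tail v) ≡ G 1
  tail-sum = sumDrop-telescope (tail v) (G ∘ suc) (vanish ∘ s≤s) (diff ∘ suc) 0
sumDrop-telescope {suc k} v G vanish diff (suc p) =
  sumDrop-telescope (tail v) (G ∘ suc) (vanish ∘ s≤s) (diff ∘ suc) p

sum-nonneg : ∀ {k} (v : Vector ℤ k) → (∀ i → 0ℤ ℤ.≤ v i) → 0ℤ ℤ.≤ sum v
sum-nonneg {zero}  v 0≤v = ℤₚ.≤-refl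
sum-nonneg {suc k} v 0≤v = ℤₚ.+-mono-≤ (0≤v zero) (sum-nonneg (tail v) (0≤v ∘ suc))

sumDrop-nonneg : ∀ {k} p (v : Vector ℤ k) → (∀ i → 0ℤ ℤ.≤ v i) → 0ℤ ℤ.≤ sumDrop p v
sumDrop-nonneg         zero    v 0≤v = sum-nonneg v 0≤v
sumDrop-nonneg {zero}  (suc p) v 0≤v = ℤₚ.≤-refl
sumDrop-nonneg {suc k} (suc p) v 0≤v = sumDrop-nonneg p (tail v) (0≤v ∘ suc)

sumDrop-cong : ∀ {k} p {u v : Vector ℤ k} → (∀ i → u i ≡ v i) → sumDrop p u ≡ sumDrop p v
sumDrop-cong         zero    u≗v = sum-cong-≗ u≗v
sumDrop-cong {zero}  (suc p) u≗v = refl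
sumDrop-cong {suc k} (suc p) u≗v = sumDrop-cong p (u≗v ∘ suc)

ZeroOrOne-nonneg : ∀ {x} → ZeroOrOne x → 0ℤ ℤ.≤ x
ZeroOrOne-nonneg (inj₁ refl) = ℤₚ.≤-refl
ZeroOrOne-nonneg (inj₂ refl) = ℤ.+≤+ z≤n

ZeroOrOne-difference : ∀ {x y} → ZeroOrOne x → ZeroOrOne y →
                       x ℤ.- y ≡ -1ℤ ⊎ x ℤ.- y ≡ 0ℤ ⊎ x ℤ.- y ≡ 1ℤ
ZeroOrOne-difference (inj₁ refl) (inj₁ refl) = inj₂ (inj₁ refl)
ZeroOrOne-difference (inj₁ refl) (inj₂ refl) = inj₁ refl
ZeroOrOne-difference (inj₂ refl) (inj₁ refl) = inj₂ (inj₂ refl)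
ZeroOrOne-difference (inj₂ refl) (inj₂ refl) = inj₂ (inj₁ refl)

-- Unit steps

Step : ℕ → ℕ → Set
Step x y = x ≡ y ⊎ x ≡ suc y

≤⇒step : ∀ {x y} → y ≤ x → x ≤ suc y → Step x y
≤⇒step y≤x x≤1+y with m≤n⇒m<n∨m≡n x≤1+y
... | inj₁ x<1+y = inj₁ (≤-antisym (s≤s⁻¹ x<1+y) y≤x)
... | inj₂ x≡1+y = inj₂ x≡1+y

step⇒≥ : ∀ {x y} → Step x y → y ≤ x
step⇒≥ (inj₁ refl) = ≤-refl
step⇒≥ (inj₂ refl) = n≤1+n _

step⇒≤ : ∀ {x y} → Step x y → x ≤ suc y
step⇒≤ (inj₁ refl) = n≤1+n _
step⇒≤ (inj₂ refl) = ≤-refl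

≡⇒difference : ∀ {x y} → x ≡ y → + x ℤ.- + y ≡ 0ℤ
≡⇒difference {x} refl = ℤₚ.+-inverseʳ (+ x)

≡suc⇒difference : ∀ {x y} → x ≡ suc y → + x ℤ.- + y ≡ 1ℤ
≡suc⇒difference {y = y} refl = sym (x≡x+y-y 1ℤ (+ y))

difference⇒≡ : ∀ {x y} → + x ℤ.- + y ≡ 0ℤ → x ≡ y
difference⇒≡ {x} {y} eq = ℤₚ.+-injective (ℤₚ.i-j≡0⇒i≡j (+ x) (+ y) eq)

difference⇒≡suc : ∀ {x y} → + x ℤ.- + y ≡ 1ℤ → x ≡ suc y
difference⇒≡suc {x} {y} eq =
  ℤₚ.+-injective (trans (x≡x-y+y (+ x) (+ y)) (cong (ℤ._+ + y) eq))

step⇒difference : ∀ {x y} → Step x y → ZeroOrOne (+ x ℤ.- + y)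
step⇒difference (inj₁ eq) = inj₁ (≡⇒difference eq)
step⇒difference (inj₂ eq) = inj₂ (≡suc⇒difference eq)

difference⇒step : ∀ {x y} → ZeroOrOne (+ x ℤ.- + y) → Step x y
difference⇒step (inj₁ eq) = inj₁ (difference⇒≡ eq)
difference⇒step (inj₂ eq) = inj₂ (difference⇒≡suc eq)

antitone : (N : ℕ → ℕ) → (∀ j → Step (N j) (N (suc j))) → ∀ {i j} → i ≤ j → N j ≤ N i
antitone N step {zero}  {zero}  _   = ≤-refl
antitone N step {zero}  {suc j} _   = ≤-trans (step⇒≥ (step j)) (antitone N step z≤n)
antitone N step {suc i} {suc j} i≤j = antitone (N ∘ suc) (step ∘ suc) (s≤s⁻¹ i≤j)

-- A discrete intermediate value argument: scan for the first descent to `x` or below.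
lastAbove : ∀ K (N : ℕ → ℕ) x → x < N 0 → N K ≤ x →
            Σ[ i ∈ Fin K ] x < N (toℕ i) × N (suc (toℕ i)) ≤ x
lastAbove zero    N x x<N0 N0≤x = contradiction x<N0 (≤⇒≯ N0≤x)
lastAbove (suc K) N x x<N0 NK≤x with x <? N 1
... | no x≮N1  = zero , x<N0 , ≮⇒≥ x≮N1
... | yes x<N1 with i , above , below ← lastAbove K (N ∘ suc) x x<N1 NK≤x
               = suc i , above , below

-- Lengths of the diagonals of the shifted diagram.

part≤largestPart : ∀ {n} .{{_ : NonZero n}} (μ : DistinctPartition n) k →
                   part μ k ≤ largestPart μ
part≤largestPart {suc _} μ k = nonincreasing μ z≤n

module _ {n} (μ : DistinctPartition n) where

  part-antitone : ∀ {k κ : Fin n} → toℕ κ < toℕ k → part μ k < part μ κ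
  part-antitone {k} {κ} κ<k = ≤∧≢⇒< (nonincreasing μ (<⇒≤ κ<k)) λ eq →
    <⇒≢ κ<k (cong toℕ (sym (distinct μ eq)))

  part-antitone⁻¹ : ∀ {k κ : Fin n} → part μ k < part μ κ → toℕ κ < toℕ k
  part-antitone⁻¹ {k} {κ} k<κ = ≰⇒> λ k≤κ → ≤⇒≯ (nonincreasing μ k≤κ) k<κ

  successor-part : ∀ {q} (k k⁺ : Fin n) → toℕ k⁺ ≡ suc (toℕ k) → q < part μ k⁺ → suc q < part μ k
  successor-part k k⁺ eq q<μ = ≤-<-trans q<μ (part-antitone (≤-reflexive (sym eq)))

  -- Row `k` of the diagram meets diagonal `q` exactly when `q < part μ k`. As the parts decrease,
  -- these rows form an initial segment.
  diagonalThreshold : ∀ q → Threshold (λ k → q < part μ k)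
  diagonalThreshold q = threshold (λ k → q <? part μ k) λ k k⁺ eq q<μ →
    <-trans (n<1+n q) (successor-part k k⁺ eq q<μ)

  diagonalLength : ℕ → ℕ
  diagonalLength q = value (diagonalThreshold q)

  IsPart : ℕ → Set
  IsPart p = ∃[ k ] p ≡ part μ k

  -- If `suc q` is the part with index `κ`, strictness of the parts makes the rows up to `κ` the
  -- ones that meet diagonal `q`, and the rows before `κ` the ones that meet diagonal `suc q`.
  diagonalLength-part : ∀ q → IsPart (suc q) →
                        diagonalLength q ≡ suc (diagonalLength (suc q))
  diagonalLength-part q (κ , eq) = trans
    (value-unique (diagonalThreshold q) {suc (toℕ κ)} (toℕ<n κ) λ k → mk⇔
      (λ k≤κ → ≤-trans (≤-reflexive eq) (nonincreasing μ (s≤s⁻¹ k≤κ)))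
      (λ q<k → s≤s (≮⇒≥ λ κ<k → <⇒≱ (part-antitone κ<k) (≤-trans (≤-reflexive (sym eq)) q<k))))
    (cong suc (sym (value-unique (diagonalThreshold (suc q)) {toℕ κ} (<⇒≤ (toℕ<n κ)) λ k → mk⇔
      (λ k<κ → ≤-trans (≤-reflexive (cong suc eq)) (part-antitone k<κ))
      (λ 1+q<k → part-antitone⁻¹ (≤-trans (≤-reflexive (cong suc (sym eq))) 1+q<k)))))

  -- No row ends on diagonal `q`, so each row that meets it continues to the next diagonal.
  diagonalLength-nonpart : ∀ q → ¬ IsPart (suc q) →
                           diagonalLength q ≡ diagonalLength (suc q)
  diagonalLength-nonpart q ¬part =
    value-unique (diagonalThreshold q) (bounded (diagonalThreshold (suc q))) λ k → mk⇔
      (<-trans (n<1+n q) ∘ to (spec (diagonalThreshold (suc q)) k))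
      (λ q<k → from (spec (diagonalThreshold (suc q)) k) (≤∧≢⇒< q<k λ eq → ¬part (k , eq)))

-- Corner sums

-- The first index of `N` is a diagonal, that is a matrix column, and the second a matrix row.
-- Vanishing outside the matrix lets the step conditions hold at all natural indices. `U-turn` says
-- `N 0 (2j) = n − j`, written additively to avoid truncated subtraction.
record CornerSums {n} .{{_ : NonZero n}} (μ : DistinctPartition n) (N : ℕ → ℕ → ℕ) : Set where
  field
    vanish-columns : ∀ {q} j → largestPart μ ≤ q → N q j ≡ 0
    vanish-rows    : ∀ q {j} → n * 2 ≤ j → N q j ≡ 0
    step-row       : ∀ q j → Step (N q j) (N q (suc j))
    step-column    : ∀ q j → Step (N q j) (N (suc q) j)
    total          : ∀ q → N q 0 ≡ diagonalLength μ q
    U-turn         : ∀ i j → i + j ≡ n → N 0 (j * 2) ≡ i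

  N≤n : ∀ q j → N q j ≤ n
  N≤n q j = ≤-trans (antitone (N q) (step-row q) z≤n)
    (≤-trans (≤-reflexive (total q)) (bounded (diagonalThreshold μ q)))

  <N⇒<part : ∀ {q} k j → toℕ k < N q j → q < part μ k
  <N⇒<part {q} k j k<N = to (spec (diagonalThreshold μ q) k)
    (<-≤-trans k<N (≤-trans (antitone (N q) (step-row q) z≤n) (≤-reflexive (total q))))

-- For a tableau this is the indicator of the label of matrix row `j` occurring on diagonal `q`; for
-- a matrix it is the sum of row `j` from column `q` on.
δ : (ℕ → ℕ → ℕ) → ℕ → ℕ → ℤ
δ N q j = + N q j ℤ.- + N q (suc j)

IsMixedDifference : ∀ {r m} → (ℕ → ℕ → ℕ) → Matrix ℤ r m → Set
IsMixedDifference N a = ∀ i q → a i q ≡ δ N (toℕ q) (toℕ i) ℤ.- δ N (suc (toℕ q)) (toℕ i)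

0-0≡0 : ∀ {x y} → x ≡ 0 → y ≡ 0 → + x ℤ.- + y ≡ 0ℤ
0-0≡0 refl refl = refl

module _ {r m} (N : ℕ → ℕ → ℕ) (a : Matrix ℤ r m)
         (vanish-columns : ∀ {q} j → m ≤ q → N q j ≡ 0)
         (vanish-rows : ∀ q {j} → r ≤ j → N q j ≡ 0)
         (mixed : IsMixedDifference N a) where

  row-sum : ∀ i q → sumDrop q (a i) ≡ δ N q (toℕ i)
  row-sum i = sumDrop-telescope (a i) (λ q → δ N q (toℕ i))
    (λ m≤q → 0-0≡0 (vanish-columns _ m≤q) (vanish-columns _ m≤q)) (mixed i)

  -- The two differences commute, so the entry is also a difference along its column and the
  -- telescoping runs vertically.
  column-sum : ∀ q j → sumDrop j (λ i → a i q) ≡ + N (toℕ q) j ℤ.- + N (suc (toℕ q)) j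
  column-sum q = sumDrop-telescope (λ i → a i q) (λ j → + N (toℕ q) j ℤ.- + N (suc (toℕ q)) j)
    (λ r≤j → 0-0≡0 (vanish-rows _ r≤j) (vanish-rows _ r≤j))
    (λ i → trans (mixed i q) (exchange-differences
      (+ N (toℕ q) (toℕ i)) (+ N (toℕ q) (suc (toℕ i)))
      (+ N (suc (toℕ q)) (toℕ i)) (+ N (suc (toℕ q)) (suc (toℕ i)))))

  -- Telescoping in both directions undoes both differences, so the matrix determines `N`.
  corner-sum : ∀ q j → sumDrop j (λ i → sumDrop q (a i)) ≡ + N q j
  corner-sum q = sumDrop-telescope (λ i → sumDrop q (a i)) (λ j → + N q j)
    (λ r≤j → cong +_ (vanish-rows q r≤j)) (λ i → row-sum i q)

-- Corner sums and the conditions (UA1)-(UA5).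

module _ {n} .{{_ : NonZero n}} {μ : DistinctPartition n}
         {a : Matrix ℤ (n * 2) (largestPart μ)} where

  cornerSums⇒UA : ∀ {N} → CornerSums μ N → IsMixedDifference N a → IsUA μ a
  cornerSums⇒UA {N} C mixed = record
    { UA1 = λ i q → subst (λ x → x ≡ -1ℤ ⊎ x ≡ 0ℤ ⊎ x ≡ 1ℤ) (sym (mixed i q))
        (ZeroOrOne-difference (step⇒difference (step-row _ _)) (step⇒difference (step-row _ _)))
    ; UA2 = λ i p → subst ZeroOrOne
        (sym (trans (sumFrom≡sumDrop p (a i)) (row-sums i (toℕ p))))
        (step⇒difference (step-row _ _))
    ; UA3 = λ j q → subst ZeroOrOne
        (sym (trans (sumFrom≡sumDrop j (λ i → a i q)) (column-sums q (toℕ j))))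
        (step⇒difference (step-column _ _))
    -- The pair sum is `N 0 (2k) − N 0 (2k + 2)`, which `U-turn` evaluates as
    -- `(n − k) − (n − k − 1)`.
    ; UA4 = λ k → trans (row-pair-sum k) (≡suc⇒difference (trans
        (U-turn (suc (toℕ (opposite k))) (toℕ k)
          (trans (sym (+-suc _ (toℕ k))) (opposite-+ k)))
        (cong suc (sym (U-turn (toℕ (opposite k)) (suc (toℕ k)) (opposite-+ k))))))
    ; UA5 = λ q →
        (λ part → trans (column-sums q 0) (≡suc⇒difference
          (trans (total _) (trans (diagonalLength-part μ _ part) (cong suc (sym (total _)))))))
      , (λ ¬part → trans (column-sums q 0) (≡⇒difference
          (trans (total _) (trans (diagonalLength-nonpart μ _ ¬part) (sym (total _))))))
    }
    where
    open CornerSums C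
    row-sums    = row-sum N a vanish-columns vanish-rows mixed
    column-sums = column-sum N a vanish-columns vanish-rows mixed

    -- Adding the mixed differences of two consecutive rows cancels the middle terms. What remains
    -- is a mixed difference with row step two, which telescopes over the columns.
    row-pair-sum : ∀ k → sum (λ q → a (combine k 0F) q ℤ.+ a (combine k 1F) q) ≡
                         + N 0 (toℕ k * 2) ℤ.- + N 0 (suc (toℕ k) * 2)
    row-pair-sum k = sumDrop-telescope
      (λ q → a (combine k 0F) q ℤ.+ a (combine k 1F) q)
      (λ q → + N q (toℕ k * 2) ℤ.- + N q (suc (toℕ k) * 2))
      (λ m≤q → 0-0≡0 (vanish-columns _ m≤q) (vanish-columns _ m≤q))
      (λ q → trans (cong₂ ℤ._+_ (row₀ q) (row₁ q)) (join-differences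
        (+ N (toℕ q) (toℕ k * 2))
        (+ N (toℕ q) (suc (toℕ k * 2)))
        (+ N (toℕ q) (suc (toℕ k) * 2))
        (+ N (suc (toℕ q)) (toℕ k * 2))
        (+ N (suc (toℕ q)) (suc (toℕ k * 2)))
        (+ N (suc (toℕ q)) (suc (toℕ k) * 2))))
      0
      where
      row₀ : ∀ q → a (combine k 0F) q ≡ δ N (toℕ q) (toℕ k * 2) ℤ.- δ N (suc (toℕ q)) (toℕ k * 2)
      row₀ q = trans (mixed (combine k 0F) q)
        (cong (λ j → δ N (toℕ q) j ℤ.- δ N (suc (toℕ q)) j) (toℕ-combine₀ k))
      row₁ : ∀ q → a (combine k 1F) q ≡
             δ N (toℕ q) (suc (toℕ k * 2)) ℤ.- δ N (suc (toℕ q)) (suc (toℕ k * 2))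
      row₁ q = trans (mixed (combine k 1F) q)
        (cong (λ j → δ N (toℕ q) j ℤ.- δ N (suc (toℕ q)) j) (toℕ-combine₁ k))

  module UA⇒CornerSums (isUA : IsUA μ a) where

    open IsUA isUA

    -- The absolute value only casts to `ℕ`: a corner sum adds up row suffix sums, each of them 0 or
    -- 1 by (UA2).
    N : ℕ → ℕ → ℕ
    N q j = ∣ sumDrop j (λ i → sumDrop q (a i)) ∣

    row-ZeroOrOne : ∀ i q → ZeroOrOne (sumDrop q (a i))
    row-ZeroOrOne i q with q <? largestPart μ
    ... | no  q≮m = inj₁ (sumDrop-vanish (a i) (≮⇒≥ q≮m))
    ... | yes q<m = subst ZeroOrOne
      (trans (sumFrom≡sumDrop (fromℕ< q<m) (a i)) (cong (λ p → sumDrop p (a i)) (toℕ-fromℕ< q<m)))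
      (UA2 i (fromℕ< q<m))

    column-ZeroOrOne : ∀ q j → ZeroOrOne (sumDrop j (λ i → a i q))
    column-ZeroOrOne q j with j <? n * 2
    ... | no  j≮r = inj₁ (sumDrop-vanish (λ i → a i q) (≮⇒≥ j≮r))
    ... | yes j<r = subst ZeroOrOne
      (trans (sumFrom≡sumDrop (fromℕ< j<r) (λ i → a i q))
        (cong (λ p → sumDrop p (λ i → a i q)) (toℕ-fromℕ< j<r)))
      (UA3 (fromℕ< j<r) q)

    +N : ∀ q j → + N q j ≡ sumDrop j (λ i → sumDrop q (a i))
    +N q j = ℤₚ.0≤i⇒+∣i∣≡i (sumDrop-nonneg j (λ i → sumDrop q (a i))
      λ i → ZeroOrOne-nonneg (row-ZeroOrOne i q))

    δN : ∀ q i → δ N q (toℕ i) ≡ sumDrop q (a i)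
    δN q i = trans (cong₂ ℤ._-_ (+N q (toℕ i)) (+N q (suc (toℕ i))))
      (sym (entry-difference (λ i → sumDrop q (a i)) i))

    mixed : IsMixedDifference N a
    mixed i q = trans (entry-difference (a i) q)
      (sym (cong₂ ℤ._-_ (δN (toℕ q) i) (δN (suc (toℕ q)) i)))

    vanish-columns : ∀ {q} j → largestPart μ ≤ q → N q j ≡ 0
    vanish-columns {q} j m≤q = cong ∣_∣ (sumDrop-telescope {n * 2}
      (λ i → sumDrop q (a i)) (λ _ → 0ℤ) (λ _ → refl) (λ i → sumDrop-vanish (a i) m≤q) j)

    vanish-rows : ∀ q {j} → n * 2 ≤ j → N q j ≡ 0
    vanish-rows q r≤j = cong ∣_∣ (sumDrop-vanish (λ i → sumDrop q (a i)) r≤j)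

    column-sums = column-sum N a vanish-columns vanish-rows mixed

    step-row : ∀ q j → Step (N q j) (N q (suc j))
    step-row q j with j <? n * 2
    ... | no  j≮r = inj₁ (trans (vanish-rows q (≮⇒≥ j≮r))
      (sym (vanish-rows q (m≤n⇒m≤1+n (≮⇒≥ j≮r)))))
    ... | yes j<r = subst (λ j → Step (N q j) (N q (suc j))) (toℕ-fromℕ< j<r)
      (difference⇒step (subst ZeroOrOne (sym (δN q (fromℕ< j<r))) (row-ZeroOrOne (fromℕ< j<r) q)))

    step-column : ∀ q j → Step (N q j) (N (suc q) j)
    step-column q j with q <? largestPart μ
    ... | no  q≮m = inj₁ (trans (vanish-columns j (≮⇒≥ q≮m))
      (sym (vanish-columns j (m≤n⇒m≤1+n (≮⇒≥ q≮m)))))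
    ... | yes q<m = subst (λ q → Step (N q j) (N (suc q) j)) (toℕ-fromℕ< q<m)
      (difference⇒step
        (subst ZeroOrOne (column-sums (fromℕ< q<m) j) (column-ZeroOrOne (fromℕ< q<m) j)))

    -- The column sum prescribed by (UA5) is exactly the drop in diagonal length from `q` to
    -- `suc q`.
    column-total : ∀ q → N (suc (toℕ q)) 0 ≡ diagonalLength μ (suc (toℕ q)) →
                   N (toℕ q) 0 ≡ diagonalLength μ (toℕ q)
    column-total q eq with any? (λ k → suc (toℕ q) ≟ part μ k)
    ... | yes part = trans
      (difference⇒≡suc (trans (sym (column-sums q 0)) (proj₁ (UA5 q) part)))
      (trans (cong suc eq) (sym (diagonalLength-part μ _ part)))
    ... | no ¬part = trans
      (difference⇒≡ (trans (sym (column-sums q 0)) (proj₂ (UA5 q) ¬part)))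
      (trans eq (sym (diagonalLength-nonpart μ _ ¬part)))

    total-beyond : ∀ {q} → largestPart μ ≤ q → N q 0 ≡ diagonalLength μ q
    total-beyond {q} m≤q = trans (vanish-columns 0 m≤q)
      (sym (value-unique (diagonalThreshold μ q) z≤n λ k → mk⇔ (λ ())
        λ q<k → contradiction (≤-trans (part≤largestPart μ k) m≤q) (<⇒≱ q<k)))

    total : ∀ q → N q 0 ≡ diagonalLength μ q
    -- Induction from the right edge inwards, on a bound `d` for the distance to that edge;
    -- `largestPart μ` is large enough for every `q`.
    total q = downward (largestPart μ) q (m≤n+m _ q)
      where
      downward : ∀ d q → largestPart μ ≤ q + d → N q 0 ≡ diagonalLength μ q
      downward zero    q m≤q+0 = total-beyond (≤-trans m≤q+0 (≤-reflexive (+-identityʳ q)))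
      downward (suc d) q m≤q+d with q <? largestPart μ
      ... | no  q≮m = total-beyond (≮⇒≥ q≮m)
      ... | yes q<m with downward d (suc q) (≤-trans m≤q+d (≤-reflexive (+-suc q d)))
      ...   | ih = subst (λ q → N q 0 ≡ diagonalLength μ q) (toℕ-fromℕ< q<m)
        (column-total (fromℕ< q<m)
          (subst (λ q → N (suc q) 0 ≡ diagonalLength μ (suc q)) (sym (toℕ-fromℕ< q<m)) ih))

    row-pair : ∀ k → N 0 (toℕ k * 2) ≡ suc (N 0 (suc (toℕ k) * 2))
    row-pair k = difference⇒≡suc (begin
      + N 0 (toℕ k * 2) ℤ.- + N 0 (suc (toℕ k) * 2)
        ≡⟨ split (+ N 0 (toℕ k * 2)) (+ N 0 (suc (toℕ k * 2))) (+ N 0 (suc (toℕ k) * 2)) ⟩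
      δ N 0 (toℕ k * 2) ℤ.+ δ N 0 (suc (toℕ k * 2))
        ≡⟨ cong₂ (λ i j → δ N 0 i ℤ.+ δ N 0 j) (toℕ-combine₀ k) (toℕ-combine₁ k) ⟨
      δ N 0 (toℕ (combine k 0F)) ℤ.+ δ N 0 (toℕ (combine k 1F))
        ≡⟨ cong₂ ℤ._+_ (δN 0 (combine k 0F)) (δN 0 (combine k 1F)) ⟩
      sum (a (combine k 0F)) ℤ.+ sum (a (combine k 1F))
        ≡⟨ ∑-distrib-+ (a (combine k 0F)) (a (combine k 1F)) ⟨
      sum (λ q → a (combine k 0F) q ℤ.+ a (combine k 1F) q)
        ≡⟨ UA4 k ⟩
      1ℤ ∎)
      where
      open ≡-Reasoning
      split : ∀ x y z → x ℤ.- z ≡ (x ℤ.- y) ℤ.+ (y ℤ.- z)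
      split = solve-∀

    -- Induction upwards from the bottom edge, one pair of rows at a time. For `i = 0` the index
    -- `j * 2` is already past the last row.
    U-turn : ∀ i j → i + j ≡ n → N 0 (j * 2) ≡ i
    U-turn zero    j refl = vanish-rows 0 ≤-refl
    U-turn (suc i) j eq   = trans
      (subst (λ j → N 0 (j * 2) ≡ suc (N 0 (suc j * 2))) (toℕ-fromℕ< j<n) (row-pair (fromℕ< j<n)))
      (cong suc (U-turn i (suc j) (trans (+-suc i j) eq)))
      where
      j<n : j < n
      j<n = ≤-trans (s≤s (m≤n+m j i)) (≤-reflexive eq)

    cornerSums : CornerSums μ N
    cornerSums = record
      { vanish-columns = vanish-columns
      ; vanish-rows    = vanish-rows
      ; step-row       = step-row
      ; step-column    = step-column
      ; total          = total
      ; U-turn         = U-turn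
      }

-- From tableaux to corner sums

-- In the coordinates row `i` and diagonal `q = j − i`, membership in the diagram is the single
-- inequality `q < part μ i`.
box : ∀ {n} (μ : DistinctPartition n) {i q} → q < part μ i → (i , toℕ i + q) ∈SF μ
box μ {i} {q} q<μ =
  m≤m+n (toℕ i) q , <-≤-trans (+-monoʳ-< (toℕ i) q<μ) (≤-reflexive (+-comm (toℕ i) _))

unbox : ∀ {n} (μ : DistinctPartition n) {i j} → (i , j) ∈SF μ → j ∸ toℕ i < part μ i
unbox μ {i} {j} (i≤j , j<μ) =
  +-cancelʳ-< (toℕ i) _ _ (≤-<-trans (≤-reflexive (m∸n+n≡m i≤j)) j<μ)

-- Needed for `recompute`, which turns the irrelevant membership proof of a filling into a usable
-- one.
∈SF? : ∀ {n} (μ : DistinctPartition n) i j → Dec ((i , j) ∈SF μ)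
∈SF? μ i j = (toℕ i ≤? j) ×-dec (j <? part μ i + toℕ i)

module _ {n} {μ : DistinctPartition n} where

  η-cong : (T : ST μ) → ∀ i {j j′} → j ≡ j′ →
           .(b : (i , j) ∈SF μ) .(b′ : (i , j′) ∈SF μ) → η T i j b ≡ η T i j′ b′
  η-cong T i refl b b′ = refl

  module _ (T : ST μ) where

    entryLetter : ∀ i q → .(q < part μ i) → Letter n
    entryLetter i q b = η T i (toℕ i + q) (box μ b)

    entryRow : ∀ i q → .(q < part μ i) → ℕ
    entryRow i q b = toℕ (row (entryLetter i q b))

    entryRow-row : ∀ i q (b : q < part μ i) (b′ : suc q < part μ i) →
                   entryRow i (suc q) b′ ≤ entryRow i q b
    entryRow-row i q b b′ = ≤ᴸ⇒row≤
      (entryLetter i q b) (entryLetter i (suc q) b′)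
      (subst (entryLetter i q b ≤ᴸ_)
      (η-cong T i (sym (+-suc (toℕ i) q)) next (box μ b′))
      (rows T i (toℕ i + q) (box μ b) next))
      where
      next : (i , suc (toℕ i + q)) ∈SF μ
      next = subst (λ j → (i , j) ∈SF μ) (+-suc (toℕ i) q) (box μ b′)

    -- The box beneath one on diagonal `suc q` lies on diagonal `q`, which gives the second half of
    -- the interlacing.
    entryRow-column : ∀ i i⁺ q → toℕ i⁺ ≡ suc (toℕ i) →
                      (b : suc q < part μ i) (b′ : q < part μ i⁺) →
                      entryRow i⁺ q b′ ≤ entryRow i (suc q) b
    entryRow-column i i⁺ q eq b b′ = ≤ᴸ⇒row≤
      (entryLetter i (suc q) b) (entryLetter i⁺ q b′)
      (subst (entryLetter i (suc q) b ≤ᴸ_)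
      (η-cong T i⁺ shift below (box μ b′))
      (columns T i i⁺ (toℕ i + suc q) eq (box μ b) below))
      where
      shift : toℕ i + suc q ≡ toℕ i⁺ + q
      shift = trans (+-suc (toℕ i) q) (cong (_+ q) (sym eq))
      below : (i⁺ , toℕ i + suc q) ∈SF μ
      below = subst (λ j → (i⁺ , j) ∈SF μ) (sym shift) (box μ b′)

    entryRow-diagonal : ∀ i i⁺ q → toℕ i⁺ ≡ suc (toℕ i) →
                        (b : q < part μ i) (b′ : q < part μ i⁺) →
                        entryRow i⁺ q b′ < entryRow i q b
    entryRow-diagonal i i⁺ q eq b b′ = <ᴸ⇒row<
      (entryLetter i q b) (entryLetter i⁺ q b′)
      (subst (entryLetter i q b <ᴸ_)
      (η-cong T i⁺ shift next (box μ b′))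
      (diagonals T i i⁺ (toℕ i + q) eq (box μ b) next))
      where
      shift : suc (toℕ i + q) ≡ toℕ i⁺ + q
      shift = cong (_+ q) (sym eq)
      next : (i⁺ , suc (toℕ i + q)) ∈SF μ
      next = subst (λ j → (i⁺ , j) ∈SF μ) (sym shift) (box μ b′)

    entryLetter-main : ∀ i (b : 0 < part μ i) →
                       entryLetter i 0 b ≡ unbarred i ⊎ entryLetter i 0 b ≡ barred i
    entryLetter-main i b =
      subst (λ c → c ≡ unbarred i ⊎ c ≡ barred i) (η-cong T i (sym (+-identityʳ _)) main (box μ b))
        (diagonal T i main)
      where
      main : (i , toℕ i) ∈SF μ
      main = subst (λ j → (i , j) ∈SF μ) (+-identityʳ _) (box μ b)

    entryRow-main : ∀ i (b : 0 < part μ i) →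
                    Step (entryRow i 0 b) (toℕ (opposite i) * 2)
    entryRow-main i b with entryLetter-main i b
    ... | inj₁ eq = inj₁ (trans (cong (toℕ ∘ row) eq) (toℕ-combine₀ (opposite i)))
    ... | inj₂ eq = inj₂ (trans (cong (toℕ ∘ row) eq) (toℕ-combine₁ (opposite i)))

    Below : ℕ → ℕ → Fin n → Set
    Below q j k = Σ[ b ∈ q < part μ k ] j ≤ entryRow k q b

    below? : ∀ q j → Decidable (Below q j)
    below? q j k with q <? part μ k
    ... | no q≮μ = no (q≮μ ∘ proj₁)
    ... | yes b  = map′ (b ,_) proj₂ (j ≤? entryRow k q b)

    -- Letters increase strictly along a diagonal, so the preceding entry lies at least one matrix
    -- row lower. This gives both the initial segment property and the upper bound in `step-row`.
    below-suc : ∀ q j k k⁺ → toℕ k⁺ ≡ suc (toℕ k) → Below q j k⁺ → Below q (suc j) k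
    below-suc q j k k⁺ eq (b′ , j≤) = b , ≤-<-trans j≤ (entryRow-diagonal k k⁺ q eq b b′)
      where
      b : q < part μ k
      b = <-trans (n<1+n q) (successor-part μ k k⁺ eq b′)

    below-pred : ∀ q j k → Below q (suc j) k → Below q j k
    below-pred q j k (b , 1+j≤) = b , <⇒≤ 1+j≤

    belowThreshold : ∀ q j → Threshold (Below q j)
    belowThreshold q j = threshold (below? q j) λ k k⁺ eq → below-pred q j k ∘ below-suc q j k k⁺ eq

    cornerSum : ℕ → ℕ → ℕ
    cornerSum q j = value (belowThreshold q j)

    cornerSum-unique : ∀ {N : ℕ → ℕ → ℕ} → (∀ q j → N q j ≤ n) →
                       (∀ q j k → toℕ k < N q j ⇔ Below q j k) → ∀ q j → cornerSum q j ≡ N q j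
    cornerSum-unique N≤n spec′ q j = value-unique (belowThreshold q j) (N≤n q j) (spec′ q j)

    -- Entry `k` of the main diagonal occupies one of the rows `2x` and `2x + 1` with
    -- `x = n − 1 − k`. The even threshold `2j` never separates such a pair, so the entry is counted
    -- exactly when `j ≤ x`; `half` is this parity argument.
    cornerSum-U-turn : ∀ i j → i + j ≡ n → cornerSum 0 (j * 2) ≡ i
    cornerSum-U-turn i j i+j≡n = value-unique (belowThreshold 0 (j * 2))
      (≤-trans (m≤m+n i j) (≤-reflexive i+j≡n)) λ k → mk⇔
        (λ k<i → positive μ k , ≤-trans
          (*-monoˡ-≤ 2 (≤-exchange {x = i} {suc (toℕ k)} (sum≡ k) k<i))
          (step⇒≥ (entryRow-main k (positive μ k))))
        (λ (b , 2j≤) → ≤-exchange {a = suc (toℕ k)} {i} {toℕ (opposite k)} {j}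
          (trans (+-comm (suc (toℕ k)) _) (trans (sym (sum≡ k)) (+-comm j i)))
          (half (≤-trans 2j≤ (step⇒≤ (entryRow-main k b)))))
      where
      sum≡ : ∀ k → j + i ≡ toℕ (opposite k) + suc (toℕ k)
      sum≡ k = trans (+-comm j i) (trans i+j≡n (sym (opposite-+ k)))
      half : ∀ {x y} → x * 2 ≤ suc (y * 2) → x ≤ y
      half {zero}  _ = z≤n
      half {suc x} {zero}  (s≤s ())
      half {suc x} {suc y} (s≤s (s≤s h)) = s≤s (half h)

    cornerSums : .{{_ : NonZero n}} → CornerSums μ cornerSum
    cornerSums = record
      { vanish-columns = λ {q} j m≤q → value-unique (belowThreshold q j) z≤n λ k → mk⇔ (λ ())
          λ (q<μ , _) → contradiction (≤-trans (part≤largestPart μ k) m≤q) (<⇒≱ q<μ)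
      ; vanish-rows = λ q {j} r≤j → value-unique (belowThreshold q j) z≤n λ k → mk⇔ (λ ())
          λ (b , j≤) → contradiction (≤-trans r≤j j≤) (<⇒≱ (toℕ<n (row (entryLetter k q b))))
      ; step-row = λ q j → ≤⇒step
          (value-mono (belowThreshold q (suc j)) (belowThreshold q j) (below-pred q j))
          (value-shift (belowThreshold q j) (belowThreshold q (suc j)) (below-suc q j))
      -- Weakly increasing rows bound the next diagonal's count from above; weakly increasing
      -- columns, with their index shift, bound it from below.
      ; step-column = λ q j → ≤⇒step
          (value-mono (belowThreshold (suc q) j) (belowThreshold q j) λ k (b , j≤) →
            <-trans (n<1+n q) b , ≤-trans j≤ (entryRow-row k q (<-trans (n<1+n q) b) b))
          (value-shift (belowThreshold q j) (belowThreshold (suc q) j) λ k k⁺ eq (b , j≤) →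
            successor-part μ k k⁺ eq b ,
            ≤-trans j≤ (entryRow-column k k⁺ q eq (successor-part μ k k⁺ eq b) b))
      ; total = λ q → value-unique (belowThreshold q 0) (bounded (diagonalThreshold μ q)) λ k → mk⇔
          (λ k<d → to (spec (diagonalThreshold μ q) k) k<d , z≤n)
          (λ (b , _) → from (spec (diagonalThreshold μ q) k) b)
      ; U-turn = cornerSum-U-turn
      }

    occurrence-difference : ∀ (i : Fin (n * 2)) q →
      δ cornerSum q (toℕ i) ≡ (if does (occursOnDiagonal? (rowLabel i) q T) then 1ℤ else 0ℤ)
    occurrence-difference i q with occursOnDiagonal? (rowLabel i) q T
    ... | no ¬occurs = ≡⇒difference (≤-antisym
      (value-mono (belowThreshold q (toℕ i)) (belowThreshold q (suc (toℕ i))) λ k (b , i≤) →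
        b , ≤∧≢⇒< i≤ λ eq → ¬occurs
          (k , box μ b , trans (sym (rowLabel-row (entryLetter k q b)))
            (cong rowLabel (sym (toℕ-injective eq)))))
      (value-mono (belowThreshold q (suc (toℕ i))) (belowThreshold q (toℕ i)) (below-pred q (toℕ i))))
    -- Entry `k` is counted at row `i` but not at row `i + 1`, so `suc k` lies between
    -- `suc (N q (i + 1))` and `N q i`.
    ... | yes (k , (k≤ , <μ) , eq) = ≡suc⇒difference (≤-antisym
      (value-shift (belowThreshold q (toℕ i)) (belowThreshold q (suc (toℕ i))) (below-suc q (toℕ i)))
      (≤-trans
        (s≤s (≮⇒≥ λ k< →
          <⇒≢ (proj₂ (to (spec (belowThreshold q (suc (toℕ i))) k) k<)) (sym row≡)))
        (from (spec (belowThreshold q (toℕ i)) k) (b , ≤-reflexive (sym row≡)))))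
      where
      b : q < part μ k
      b = subst (_< part μ k) (m+n∸m≡n (toℕ k) q) (unbox μ (k≤ , <μ))
      row≡ : entryRow k q b ≡ toℕ i
      row≡ = cong toℕ (trans (cong row eq) (row-rowLabel {n} i))

-- The image of a tableau as a mixed difference.

⟦_⟧ : Sign → ℤ
⟦ Sign.+ ⟧ = 1ℤ
⟦ Sign.- ⟧ = 0ℤ

-- With `+` read as 1 and `-` as 0, `unsign` subtracts the right neighbour. A missing neighbour acts
-- as `-`, hence the sequence extended beyond the row and the hypothesis at `m`.
φ⁻¹Row-difference : ∀ {m} (s : ℕ → Sign) → s m ≡ Sign.- → ∀ (q : Fin m) →
                    φ⁻¹Row (λ q → s (toℕ q)) q ≡ ⟦ s (toℕ q) ⟧ ℤ.- ⟦ s (suc (toℕ q)) ⟧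
φ⁻¹Row-difference {suc zero} s s-m zero rewrite s-m with s 0
... | Sign.+ = refl
... | Sign.- = refl
φ⁻¹Row-difference {suc (suc m)} s s-m zero with s 0 | s 1
... | Sign.+ | Sign.+ = refl
... | Sign.+ | Sign.- = refl
... | Sign.- | Sign.+ = refl
... | Sign.- | Sign.- = refl
φ⁻¹Row-difference {suc (suc m)} s s-m (suc q) = φ⁻¹Row-difference (s ∘ suc) s-m q

module _ {n} .{{_ : NonZero n}} {μ : DistinctPartition n} (T : ST μ) where

  -- The rows of `ψ T` continued past the last column, where no diagonal has boxes.
  ψ-sign : Fin (n * 2) → ℕ → Sign
  ψ-sign i q = if does (occursOnDiagonal? (rowLabel i) q T) then Sign.+ else Sign.-

  ⟦ψ-sign⟧ : ∀ i q → ⟦ ψ-sign i q ⟧ ≡ δ (cornerSum T) q (toℕ i)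
  ⟦ψ-sign⟧ i q = trans (⟦if⟧ (does (occursOnDiagonal? (rowLabel i) q T)))
    (sym (occurrence-difference T i q))
    where
    ⟦if⟧ : ∀ b → ⟦ if b then Sign.+ else Sign.- ⟧ ≡ (if b then 1ℤ else 0ℤ)
    ⟦if⟧ true  = refl
    ⟦if⟧ false = refl

  ψ-sign-vanish : ∀ i → ψ-sign i (largestPart μ) ≡ Sign.-
  ψ-sign-vanish i with occursOnDiagonal? (rowLabel i) (largestPart μ) T
  ... | no  _ = refl
  ... | yes (k , (k≤ , <μ) , _) = contradiction (part≤largestPart μ k)
    (<⇒≱ (subst (_< part μ k) (m+n∸m≡n (toℕ k) (largestPart μ)) (unbox μ (k≤ , <μ))))

  Ψ-mixed : IsMixedDifference (cornerSum T) (Ψ T)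
  Ψ-mixed i q = trans (φ⁻¹Row-difference (ψ-sign i) (ψ-sign-vanish i) q)
    (cong₂ ℤ._-_ (⟦ψ-sign⟧ i (toℕ q)) (⟦ψ-sign⟧ i (suc (toℕ q))))

  Ψ-UA : IsUA μ (Ψ T)
  Ψ-UA = cornerSums⇒UA (cornerSums T) Ψ-mixed

-- From corner sums to tableaux

module CornerSums⇒ST {n} .{{_ : NonZero n}} {μ : DistinctPartition n} {N : ℕ → ℕ → ℕ}
                     (C : CornerSums μ N) where

  open CornerSums C

  -- The matrix row that entry `k` of diagonal `q` must label: `N q` starts above `k` because the
  -- diagonal has more than `k` boxes, and it ends at 0.
  position : ∀ k q → q < part μ k →
             Σ[ i ∈ Fin (n * 2) ] toℕ k < N q (toℕ i) × N q (suc (toℕ i)) ≤ toℕ k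
  position k q q<μ = lastAbove (n * 2) (N q) (toℕ k)
    (≤-trans (from (spec (diagonalThreshold μ q) k) q<μ) (≤-reflexive (sym (total q))))
    (≤-trans (≤-reflexive (vanish-rows q ≤-refl)) z≤n)

  filling : Filling μ
  filling i j b = rowLabel (proj₁ (position i (j ∸ toℕ i) (unbox μ (recompute (∈SF? μ i j) b))))

  fillingRow : ∀ i j → .((i , j) ∈SF μ) → ℕ
  fillingRow i j b = toℕ (row (filling i j b))

  -- The row of an entry is the greatest `ρ` at which the corner sum still exceeds `i`. This
  -- adjunction, split into `above` and `below`, yields all the tableau inequalities.
  fillingRow-spec : ∀ i j .(b : (i , j) ∈SF μ) ρ → ρ ≤ fillingRow i j b ⇔ toℕ i < N (j ∸ toℕ i) ρ
  fillingRow-spec i j b ρ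
    with p , above , below ← position i (j ∸ toℕ i) (unbox μ (recompute (∈SF? μ i j) b))
    rewrite row-rowLabel {n} p = mk⇔
      (λ ρ≤p → <-≤-trans above (antitone _ (step-row _) ρ≤p))
      (λ i<N → ≮⇒≥ λ p<ρ → <⇒≱ i<N (≤-trans (antitone _ (step-row _) p<ρ) below))

  above : ∀ i j .(b : (i , j) ∈SF μ) {q} → j ∸ toℕ i ≡ q → toℕ i < N q (fillingRow i j b)
  above i j b refl = to (fillingRow-spec i j b _) ≤-refl

  below : ∀ i j .(b : (i , j) ∈SF μ) {q} → j ∸ toℕ i ≡ q →
          ∀ ρ → toℕ i < N q ρ → ρ ≤ fillingRow i j b
  below i j b refl ρ = from (fillingRow-spec i j b ρ)

  -- With `x = n − 1 − i`, `U-turn` gives `N 0 (2x) = i + 1` and `N 0 (2x + 2) = i`, so the descent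
  -- past `i` happens in row `2x` or `2x + 1`.
  fillingRow-main : ∀ i .(b : (i , toℕ i) ∈SF μ) →
                    Step (fillingRow i (toℕ i) b) (toℕ (opposite i) * 2)
  fillingRow-main i b = ≤⇒step
    (below i (toℕ i) b (n∸n≡0 (toℕ i)) _ (≤-reflexive (sym
      (U-turn (suc (toℕ i)) _ (trans (+-comm (suc (toℕ i)) _) (opposite-+ i))))))
    (s≤s⁻¹ (≰⇒> λ 2+2x≤ρ → <-irrefl refl (<-≤-trans (above i (toℕ i) b (n∸n≡0 (toℕ i)))
      (≤-trans (antitone (N 0) (step-row 0) 2+2x≤ρ) (≤-reflexive
        (U-turn (toℕ i) (suc (toℕ (opposite i)))
          (trans (+-suc (toℕ i) _) (trans (+-comm (suc (toℕ i)) _) (opposite-+ i)))))))))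

  filling-main : ∀ i .(b : (i , toℕ i) ∈SF μ) →
                 filling i (toℕ i) b ≡ unbarred i ⊎ filling i (toℕ i) b ≡ barred i
  filling-main i b with fillingRow-main i b
  ... | inj₁ eq = inj₁ (row-injective (toℕ-injective (trans eq (sym (toℕ-combine₀ (opposite i))))))
  ... | inj₂ eq = inj₂ (row-injective (toℕ-injective (trans eq (sym (toℕ-combine₁ (opposite i))))))

  -- A unit step costs at most one, and moving up from tableau row `i⁺` to `i` pays for it.
  <-pred-step : ∀ {x y q j ρ} → x ≡ suc y → x < N q j → Step (N q j) ρ → y < ρ
  <-pred-step refl x<N step = s≤s⁻¹ (≤-trans x<N (step⇒≤ step))

  tableau : ST μ
  tableau = record
    { η         = filling
    ; diagonal  = filling-main
    ; rows      = λ i j b b′ → row≤⇒≤ᴸ (filling i j b) (filling i (suc j) b′)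
        (below i j b refl _ (<-≤-trans
          (above i (suc j) b′ (+-∸-assoc 1 (proj₁ (recompute (∈SF? μ i j) b))))
          (step⇒≥ (step-column (j ∸ toℕ i) _))))
    ; columns   = λ i i⁺ j eq b b′ → row≤⇒≤ᴸ (filling i j b) (filling i⁺ j b′)
        (below i j b (∸-pred eq (proj₁ (recompute (∈SF? μ i⁺ j) b′))) _
          (<-pred-step eq (above i⁺ j b′ refl) (step-column (j ∸ toℕ i⁺) _)))
    -- Here the step goes one matrix row down on the same diagonal, which makes the inequality
    -- strict.
    ; diagonals = λ i i⁺ j eq b b′ → row<⇒<ᴸ (filling i j b) (filling i⁺ (suc j) b′)
        (below i j b refl _
          (<-pred-step eq (above i⁺ (suc j) b′ (cong (suc j ∸_) eq)) (step-row (j ∸ toℕ i) _)))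
    }
    where
    ∸-pred : ∀ {x y j} → x ≡ suc y → x ≤ j → j ∸ y ≡ suc (j ∸ x)
    ∸-pred {y = y} {suc j} refl x≤j = +-∸-assoc 1 (s≤s⁻¹ x≤j)

  cornerSum-tableau : ∀ q j → cornerSum tableau q j ≡ N q j
  cornerSum-tableau = cornerSum-unique tableau {N} N≤n λ q j k → mk⇔
    (λ k<N → <N⇒<part k j k<N ,
      below k (toℕ k + q) (box μ (<N⇒<part k j k<N)) (m+n∸m≡n (toℕ k) q) j k<N)
    (λ (b , j≤) → <-≤-trans (above k (toℕ k + q) (box μ b) (m+n∸m≡n (toℕ k) q))
      (antitone (N q) (step-row q) j≤))

-- Corner sums determine tableau and matrix; bijectivity.

module _ {n} {μ : DistinctPartition n} (T U : ST μ) where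

  cornerSum-cong : T ≈ST U → ∀ q j → cornerSum T q j ≡ cornerSum U q j
  cornerSum-cong T≈U = cornerSum-unique T {cornerSum U} (λ q j → bounded (belowThreshold U q j))
    λ q j k → mk⇔
    (λ k< → let b , j≤ = to (spec (belowThreshold U q j) k) k< in
      b , subst (j ≤_) (sym (entryRow≡ k q b)) j≤)
    (λ (b , j≤) → from (spec (belowThreshold U q j) k) (b , subst (j ≤_) (entryRow≡ k q b) j≤))
    where
    entryRow≡ : ∀ k q b → entryRow T k q b ≡ entryRow U k q b
    entryRow≡ k q b = cong (toℕ ∘ row) (T≈U k (toℕ k + q) (box μ b))

  -- Entry `k` of `T` is counted at its own row. With equal corner sums it is counted there in `U`
  -- as well, so in `U` it lies in that row or lower.
  entryRow-mono : (∀ q j → cornerSum T q j ≡ cornerSum U q j) →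
                  ∀ k q b → entryRow T k q b ≤ entryRow U k q b
  entryRow-mono eq k q b = proj₂ (to (spec (belowThreshold U q _) k)
    (<-≤-trans (from (spec (belowThreshold T q _) k) (b , ≤-refl)) (≤-reflexive (eq q _))))

cornerSum-injective : ∀ {n} {μ : DistinctPartition n} (T U : ST μ) →
                      (∀ q j → cornerSum T q j ≡ cornerSum U q j) → T ≈ST U
cornerSum-injective {μ = μ} T U eq i j b = begin
  η T i j b                   ≡⟨ η-cong T i j≡ b (box μ q<μ) ⟩
  entryLetter T i q q<μ       ≡⟨ row-injective (toℕ-injective (≤-antisym
                                   (entryRow-mono T U eq i q q<μ)
                                   (entryRow-mono U T (λ q j → sym (eq q j)) i q q<μ))) ⟩
  entryLetter U i q q<μ       ≡⟨ η-cong U i j≡ b (box μ q<μ) ⟨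
  η U i j b                   ∎
  where
  open ≡-Reasoning
  b′ : (i , j) ∈SF μ
  b′ = recompute (∈SF? μ i j) b
  q : ℕ
  q = j ∸ toℕ i
  q<μ : q < part μ i
  q<μ = unbox μ b′
  j≡ : j ≡ toℕ i + q
  j≡ = sym (m+[n∸m]≡n (proj₁ b′))

mixedDifference-unique : ∀ {r m} {N M : ℕ → ℕ → ℕ} {a b : Matrix ℤ r m} →
  (∀ q j → N q j ≡ M q j) → IsMixedDifference N a → IsMixedDifference M b →
  ∀ i q → a i q ≡ b i q
mixedDifference-unique {N = N} {M} N≗M mixed-a mixed-b i q = trans (mixed-a i q)
  (trans (cong₂ ℤ._-_ (δ-cong (toℕ q)) (δ-cong (suc (toℕ q)))) (sym (mixed-b i q)))
  where
  δ-cong : ∀ q → δ N q (toℕ i) ≡ δ M q (toℕ i)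
  δ-cong q = cong₂ (λ x y → + x ℤ.- + y) (N≗M q (toℕ i)) (N≗M q (suc (toℕ i)))

module _ {n} .{{_ : NonZero n}} {μ : DistinctPartition n} where

  Ψ-cong : {T U : ST μ} → T ≈ST U → ∀ i q → Ψ T i q ≡ Ψ U i q
  Ψ-cong {T} {U} T≈U = mixedDifference-unique (cornerSum-cong T U T≈U) (Ψ-mixed T) (Ψ-mixed U)

  Ψ-injective : {T U : ST μ} → (∀ i q → Ψ T i q ≡ Ψ U i q) → T ≈ST U
  Ψ-injective {T} {U} Ψ≗ = cornerSum-injective T U λ q j → ℤₚ.+-injective (begin
    + cornerSum T q j                       ≡⟨ Ψ-corner-sum T q j ⟨
    sumDrop j (λ i → sumDrop q (Ψ T i))     ≡⟨ sumDrop-cong j (λ i → sumDrop-cong q (Ψ≗ i)) ⟩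
    sumDrop j (λ i → sumDrop q (Ψ U i))     ≡⟨ Ψ-corner-sum U q j ⟩
    + cornerSum U q j                       ∎)
    where
    open ≡-Reasoning
    Ψ-corner-sum : ∀ T q j → sumDrop j (λ i → sumDrop q (Ψ {μ = μ} T i)) ≡ + cornerSum T q j
    Ψ-corner-sum T = corner-sum (cornerSum T) (Ψ T) vanish-columns vanish-rows (Ψ-mixed T)
      where open CornerSums (cornerSums T)

  -- The tableau built from the corner sums of `a` has those same corner sums, so its image and `a`
  -- are mixed differences of one array.
  Ψ-surjective : {a : Matrix ℤ (n * 2) (largestPart μ)} → IsUA μ a →
                 Σ[ T ∈ ST μ ] ∀ i q → Ψ T i q ≡ a i q
  Ψ-surjective isUA = tableau ,
    mixedDifference-unique cornerSum-tableau (Ψ-mixed tableau) (UA⇒CornerSums.mixed isUA)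
    where open CornerSums⇒ST (UA⇒CornerSums.cornerSums isUA)

theorem4p1 : ∀ (n : ℕ) .{{_ : NonZero n}} (μ : DistinctPartition n) →
    Σ[ Ψ-isUA ∈ (∀ (T : ST μ) → IsUA μ (Ψ T)) ]
    IsBijection (_≈ST_ {μ = μ}) (_≈UA_ {μ = μ}) (λ T → Ψ T , Ψ-isUA T)
theorem4p1 n μ = Ψ-UA , record
  { isInjection = record
    { isCongruent = record
      { cong           = λ {T} {U} → Ψ-cong {T = T} {U}
      ; isEquivalence₁ = record
        { refl  = λ i j b → refl
        ; sym   = λ S≈T i j b → sym (S≈T i j b)
        ; trans = λ S≈T T≈U i j b → trans (S≈T i j b) (T≈U i j b)
        }
      ; isEquivalence₂ = record
        { refl  = λ i q → refl
        ; sym   = λ A≈B i q → sym (A≈B i q)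
        ; trans = λ A≈B B≈C i q → trans (A≈B i q) (B≈C i q)
        }
      }
    ; injective = λ {T} {U} → Ψ-injective {T = T} {U}
    }
  ; surjective = λ (a , isUA) → let T , Ψ≗a = Ψ-surjective isUA in
      T , λ {U} U≈T i q → trans (Ψ-cong {T = U} {T} U≈T i q) (Ψ≗a i q)
  }
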